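{- Let $n, m, k$ be positive integers with $(n,m) \notin \{(1,1),(2,2)\}$. Then $\mathrm{sg}(K_{n,m}) = k$ if and only if at least one of the following three conditions holds: (i) $n < k$ and $m = f(k, n)$; (ii) $m < k$ and $n = f(k, m)$; (iii) there is an integer $i$ with $0 \leq i \leq k$ such that $f(k, i-1) \leq m \leq f(k, i)$ and $f(k, k-i-1) \leq n \leq f(k, k-i)$. In the two exceptional cases, $\mathrm{sg}(K_{1,1}) = 2$ and $\mathrm{sg}(K_{2,2}) = 3$.
   Context: For integers $\alpha, \beta$ define $f(\alpha, \beta) = \alpha - 1 + \binom{\max\{\beta-1, 2\}}{2}$. $K_{n,m}$ denotes the complete bipartite graph with parts of sizes $n$ and $m$. Let $G=(V,E)$ be a finite simple graph. For a set $S\subseteq V$ and for each pair of distinct vertices $\{x,y\}\subseteq S$, select one fixed shortest path $\widetilde{g}(x,y)$ between $x$ and $y$ in $G$. If the selection can be made so that the selected shortest paths (one per pair) together cover all vertices of $G$, i.e. the union of their vertex sets is $V$, then $S$ is called a strong geodetic set of $G$. If $G$ has just one vertex, that vertex is considered the unique strong geodetic set. The strong geodetic number $\mathrm{sg}(G)$ is the minimum size of a strong geodetic set of $G$. -}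

module Defs where

open import Data.Empty using (⊥)
open import Data.Fin using (Fin; splitAt; _<_)
open import Data.Fin.Subset using (Subset; _∈_; ∣_∣; ⊤)
open import Data.Integer as ℤ using (ℤ; +_; 1ℤ)
open import Data.List using (List; []; _∷_)
open import Data.List.Membership.Propositional using () renaming (_∈_ to _∈ˡ_)
open import Data.List.Relation.Unary.Unique.Propositional using (Unique)
open import Data.Nat using (ℕ; suc; _+_; _≤_)
open import Data.Nat.Combinatorics using (_C_)
open import Data.Product using (Σ-syntax; ∃-syntax; _×_)
open import Data.Sum using (_⊎_; inj₁; inj₂)
open import Data.Unit as Unit using (tt)
open import Relation.Binary.Construct.Closure.ReflexiveTransitive using (Star; ε; _◅_)
open import Relation.Binary.Definitions using (Decidable; Symmetric)
open import Relation.Binary.PropositionalEquality using (_≡_)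
open import Relation.Nullary using (¬_; yes; no)

-- The maximum is at least 2, so taking its absolute value only changes its type.
f : ℤ → ℤ → ℤ
f α β = (α ℤ.- 1ℤ) ℤ.+ + (ℤ.∣ (β ℤ.- 1ℤ) ℤ.⊔ + 2 ∣ C 2)

record Graph (n : ℕ) : Set₁ where
  field
    Adj    : Fin n → Fin n → Set
    adj?   : Decidable Adj
    symm   : Symmetric Adj
    irrefl : ∀ {x} → ¬ Adj x x

  Walk : Fin n → Fin n → Set
  Walk = Star Adj

  vertices : ∀ {x y} → Walk x y → List (Fin n)
  vertices {x} ε       = x ∷ []
  vertices {x} (_ ◅ w) = x ∷ vertices w

  length : ∀ {x y} → Walk x y → ℕ
  length ε       = 0
  length (_ ◅ w) = suc (length w)

  IsPath : ∀ {x y} → Walk x y → Set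
  IsPath w = Unique (vertices w)

  record ShortestPath (x y : Fin n) : Set where
    field
      walk     : Walk x y
      isPath   : IsPath walk
      shortest : (w : Walk x y) → IsPath w → length walk ≤ length w

  open ShortestPath public

  -- Requiring x < y picks one representative of each unordered pair {x , y} of
  -- distinct vertices; irrelevance makes the path depend on that pair alone.
  Selection : Subset n → Set
  Selection S = ∀ x y → .(x ∈ S) → .(y ∈ S) → .(x < y) → ShortestPath x y

  Covers : ∀ {S} → Selection S → Set
  Covers {S} g =
    ∀ v → ∃[ x ] ∃[ y ] Σ[ x∈S ∈ x ∈ S ] Σ[ y∈S ∈ y ∈ S ] Σ[ x<y ∈ x < y ]
          v ∈ˡ vertices (walk (g x y x∈S y∈S x<y))

  -- The first alternative is the convention for the one-vertex graph, where
  -- there are no pairs and hence no selection covers.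
  IsStrongGeodetic : Subset n → Set
  IsStrongGeodetic S = (n ≡ 1 × S ≡ ⊤) ⊎ (Σ[ g ∈ Selection S ] Covers g)

-- sg(G) = k, as a relation: a disconnected graph with several vertices has no
-- strong geodetic set, so sg is not defined on all graphs.
sg[_]≡_ : ∀ {n} → Graph n → ℕ → Set
sg[ G ]≡ k =
  (∃[ S ] IsStrongGeodetic S × ∣ S ∣ ≡ k) ×
  (∀ S → IsStrongGeodetic S → k ≤ ∣ S ∣)
  where open Graph G

infix 4 sg[_]≡_

module _ {A B : Set} where

  OppositeSides : A ⊎ B → A ⊎ B → Set
  OppositeSides (inj₁ _) (inj₁ _) = ⊥
  OppositeSides (inj₁ _) (inj₂ _) = Unit.⊤
  OppositeSides (inj₂ _) (inj₁ _) = Unit.⊤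
  OppositeSides (inj₂ _) (inj₂ _) = ⊥

  oppositeSides? : Decidable OppositeSides
  oppositeSides? (inj₁ _) (inj₁ _) = no λ ()
  oppositeSides? (inj₁ _) (inj₂ _) = yes tt
  oppositeSides? (inj₂ _) (inj₁ _) = yes tt
  oppositeSides? (inj₂ _) (inj₂ _) = no λ ()

  oppositeSides-sym : ∀ u v → OppositeSides u v → OppositeSides v u
  oppositeSides-sym (inj₁ _) (inj₂ _) _ = tt
  oppositeSides-sym (inj₂ _) (inj₁ _) _ = tt

  oppositeSides-irrefl : ∀ u → ¬ OppositeSides u u
  oppositeSides-irrefl (inj₁ _) ()
  oppositeSides-irrefl (inj₂ _) ()

-- The complete bipartite graph: the parts are the first n and the last m elements.
K : ∀ n m → Graph (n + m)
K n m = record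
  { Adj    = λ u v → OppositeSides (splitAt n u) (splitAt n v)
  ; adj?   = λ u v → oppositeSides? (splitAt n u) (splitAt n v)
  ; symm   = λ {u} {v} → oppositeSides-sym (splitAt n u) (splitAt n v)
  ; irrefl = λ {u} → oppositeSides-irrefl (splitAt n u)
  }

{-# OPTIONS --safe #-}
module Submission where

-- A set with a vertices in one part and b in the other is strong geodetic in K n m
-- exactly when n ≤ a + C(b, 2) and m ≤ b + C(a, 2): two vertices of the same part
-- are joined by paths of length two, which cover one arbitrary vertex of the other
-- part, and an edge covers nothing but its ends. So sg is the least a + b under these
-- inequalities. As b + C(a, 2) ≤ f(a + b, a), with equality unless a is 1 or 2, and
-- f is monotone in its second argument, the least size can be read off from f.

open import Data.Bool using (true; false)
open import Data.Empty using (⊥-elim; ⊥-elim-irr)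
open import Data.Fin as Fin using (Fin; zero; suc; toℕ; fromℕ<; splitAt; _↑ˡ_; _↑ʳ_)
open import Data.Fin.Properties as Fin
  using (injective⇒≤; splitAt-↑ˡ; splitAt-↑ʳ; splitAt⁻¹-↑ˡ; splitAt⁻¹-↑ʳ; toℕ-↑ˡ; toℕ-↑ʳ;
         ↑ˡ-injective; ↑ʳ-injective; toℕ<n; toℕ-fromℕ<; toℕ-injective)
open import Data.Fin.Subset using (Subset; _∈_; ∣_∣)
open import Data.Fin.Subset.Properties using (∣p∣≤n)
open import Data.List as List using (List; []; _∷_)
open import Data.List.Membership.Propositional using (lose) renaming (_∈_ to _∈ˡ_)
open import Data.List.Membership.Propositional.Properties using (∈-map⁺; ∈-++⁺ˡ; ∈-++⁺ʳ)
open import Data.List.Properties using (length-map; length-++; ∷-injectiveˡ; ∷-injectiveʳ)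
open import Data.List.Relation.Unary.All using ([]; _∷_)
open import Data.List.Relation.Unary.AllPairs using ([]; _∷_)
open import Data.List.Relation.Unary.Any as Any using (Any; here; there)
open import Data.List.Relation.Unary.Any.Properties using (lookup-index)
open import Data.Nat using (ℕ; zero; suc; _+_; _∸_; _⊔_; _≤_; _<_; _≤?_; _<?_; z≤n; s≤s; NonZero)
open import Data.Nat.Combinatorics using (_C_; nC1≡n; nCk+nC[k+1]≡[n+1]C[k+1])
open import Data.Nat.Properties
open import Data.Product as Product using (Σ-syntax; ∃-syntax; _×_; _,_; proj₁; proj₂)
open import Data.Sum as Sum using (_⊎_; inj₁; inj₂)
open import Data.Unit using (tt)
open import Data.Vec using ([]; _∷_; _++_; take; drop; here; there)
open import Data.Vec.Properties
  using (lookup-++ˡ; lookup-++ʳ; take++drop≡id; lookup⇒[]=; []=⇒lookup)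
open import Function using (_∘_)
open import Function.Bundles using (_⇔_; mk⇔)
open import Relation.Binary.Construct.Closure.ReflexiveTransitive using (ε; _◅_)
open import Relation.Binary.Definitions using (tri<; tri≈; tri>)
open import Relation.Binary.PropositionalEquality
open import Relation.Nullary using (¬_; Dec; yes; no; contradiction)
open import Defs

-- Binomial coefficients C(n, 2)

pascal₂ : ∀ n → suc n C 2 ≡ n + n C 2
pascal₂ n = trans (sym (nCk+nC[k+1]≡[n+1]C[k+1] n 1)) (cong (_+ n C 2) (nC1≡n n))

C₂-mono : ∀ {i j} → i ≤ j → i C 2 ≤ j C 2
C₂-mono z≤n = z≤n
C₂-mono {suc i} {suc j} (s≤s i≤j) = begin
  suc i C 2  ≡⟨ pascal₂ i ⟩
  i + i C 2  ≤⟨ +-mono-≤ i≤j (C₂-mono i≤j) ⟩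
  j + j C 2  ≡⟨ pascal₂ j ⟨
  suc j C 2  ∎
  where open ≤-Reasoning

<⇒≤C₂ : ∀ {n k} → n < k → n ≤ k C 2
<⇒≤C₂ {n} {suc k} (s≤s n≤k) =
  subst (n ≤_) (sym (pascal₂ k)) (≤-trans n≤k (m≤m+n k (k C 2)))

-- Feasible pairs and their least sum

record Feasible (n m a b : ℕ) : Set where
  constructor feasible
  field
    a≤n : a ≤ n
    b≤m : b ≤ m
    n≤  : n ≤ a + b C 2
    m≤  : m ≤ b + a C 2

Feasible-swap : ∀ {n m a b} → Feasible n m a b → Feasible m n b a
Feasible-swap (feasible a≤n b≤m n≤ m≤) = feasible b≤m a≤n m≤ n≤

Minimal : ℕ → ℕ → ℕ → Set
Minimal n m k =
  (∃[ a ] ∃[ b ] Feasible n m a b × a + b ≡ k) ×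
  (∀ a b → Feasible n m a b → k ≤ a + b)

Minimal-swap : ∀ {n m k} → Minimal n m k → Minimal m n k
Minimal-swap {k = k} ((a , b , F , a+b≡k) , least) =
  (b , a , Feasible-swap F , trans (+-comm b a) a+b≡k) ,
  λ b′ a′ F′ → subst (k ≤_) (+-comm a′ b′) (least a′ b′ (Feasible-swap F′))

-- Comparison of feasibility with f

-- f(k, j) = k - 1 + h j; the comparisons of f(k, j) with m are written with
-- suc m and k + h j, which avoids the subtraction.
h : ℕ → ℕ
h j = ((j ∸ 1) ⊔ 2) C 2

h-mono : ∀ {i j} → i ≤ j → h i ≤ h j
h-mono i≤j = C₂-mono (⊔-monoˡ-≤ 2 (∸-monoˡ-≤ 1 i≤j))

1≤h : ∀ j → 1 ≤ h j
1≤h j = C₂-mono (m≤n⊔m (j ∸ 1) 2)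

≤2⇒h≡1 : ∀ {j} → j ≤ 2 → h j ≡ 1
≤2⇒h≡1 z≤n = refl
≤2⇒h≡1 (s≤s z≤n) = refl
≤2⇒h≡1 (s≤s (s≤s z≤n)) = refl

-- By Pascal's rule C(j + 1, 2) = j + C(j, 2), and the maximum in `h` can only enlarge the last
-- term.
C₂≤h : ∀ a → suc (a C 2) ≤ a + h a
C₂≤h zero    = ≤-refl
C₂≤h (suc j) = s≤s (subst (_≤ j + h (suc j)) (sym (pascal₂ j))
                 (+-monoʳ-≤ j (C₂-mono (m≤m⊔n j 2))))

-- Fails exactly for a = 1 and a = 2, where the maximum in f is too generous.
Tight : ℕ → Set
Tight a = a + h a ≤ suc (a C 2)

tight-or-small : ∀ a → Tight a ⊎ a ≤ 2
tight-or-small 0 = inj₁ ≤-refl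
tight-or-small 1 = inj₂ (s≤s z≤n)
tight-or-small 2 = inj₂ ≤-refl
tight-or-small (suc j@(suc (suc _))) =
  inj₁ (s≤s (≤-reflexive (trans
    (cong (λ l → j + l C 2) (m≥n⇒m⊔n≡m {j} (s≤s (s≤s z≤n))))
    (sym (pascal₂ j)))))

-- In shifted form this is m ≤ f(a + b, a), the only consequence of feasibility that the lower
-- bounds on sizes use.
feasible⇒< : ∀ {n m a b} → Feasible n m a b → m < a + b + h a
feasible⇒< {m = m} {a} {b} F = begin
  suc m              ≤⟨ s≤s (Feasible.m≤ F) ⟩
  suc (b + a C 2)    ≡⟨ +-suc b (a C 2) ⟨
  b + suc (a C 2)    ≤⟨ +-monoʳ-≤ b (C₂≤h a) ⟩
  b + (a + h a)      ≡⟨ +-assoc b a (h a) ⟨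
  b + a + h a        ≡⟨ cong (_+ h a) (+-comm b a) ⟩
  a + b + h a        ∎
  where open ≤-Reasoning

tight⇒≤ : ∀ {m} a b → Tight a → m < a + b + h a → m ≤ b + a C 2
tight⇒≤ {m} a b t m< = ≤-pred (begin
  suc m              ≤⟨ m< ⟩
  a + b + h a        ≡⟨ cong (_+ h a) (+-comm a b) ⟩
  b + a + h a        ≡⟨ +-assoc b a (h a) ⟩
  b + (a + h a)      ≤⟨ +-monoʳ-≤ b t ⟩
  b + suc (a C 2)    ≡⟨ +-suc b (a C 2) ⟩
  suc (b + a C 2)    ∎)
  where open ≤-Reasoning

tight⇒feasible : ∀ {n m a b} → Tight a → Tight b → a ≤ n → b ≤ m →
  m < a + b + h a → n < a + b + h b → Feasible n m a b
tight⇒feasible {n} {a = a} {b} ta tb a≤n b≤m m< n< =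
  feasible a≤n b≤m (tight⇒≤ b a tb (subst (λ s → n < s + h b) (+-comm a b) n<)) (tight⇒≤ a b ta m<)

-- The set is one whole part, whose pairs alone cover the other part.
≤⇒feasible : ∀ {n m} → n ≤ m C 2 → Feasible n m 0 m
≤⇒feasible n≤ = feasible z≤n ≤-refl n≤ (m≤m+n _ _)

-- From the conditions on f to least sizes

Extremal : ℕ → ℕ → ℕ → Set
Extremal n m k = n < k × suc m ≡ k + h n

-- Condition (iii), with `j` for k - i so that exchanging the two parts exchanges `i` and `j`.
Balanced : ℕ → ℕ → ℕ → Set
Balanced n m k = ∃[ i ] ∃[ j ] i + j ≡ k ×
  (k + h (i ∸ 1) ≤ suc m × m < k + h i) ×
  (k + h (j ∸ 1) ≤ suc n × n < k + h j)

Balanced-swap : ∀ {n m k} → Balanced n m k → Balanced m n k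
Balanced-swap (i , j , i+j≡k , P , Q) = j , i , trans (+-comm j i) i+j≡k , Q , P

-- Monotonicity gives f(k, i) ≤ m ≤ f(a + b, a) ≤ f(a + b, i), and f is strictly increasing in its
-- first argument.
size-bound : ∀ {n m a b i k} → Feasible n m a b → a ≤ i → k + h i ≤ suc m → k ≤ a + b
size-bound {m = m} {a} {b} {i} {k} F a≤i k≤ = +-cancelʳ-≤ (h i) k (a + b) (begin
  k + h i      ≤⟨ k≤ ⟩
  suc m        ≤⟨ feasible⇒< F ⟩
  a + b + h a  ≤⟨ +-monoʳ-≤ (a + b) (h-mono a≤i) ⟩
  a + b + h i  ∎)
  where open ≤-Reasoning

≰⇒≤∸1 : ∀ {i a} → ¬ i ≤ a → a ≤ i ∸ 1
≰⇒≤∸1 i≰a = ∸-monoˡ-≤ 1 (≰⇒> i≰a)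

-- If `a < i`, the lower bound f(k, i - 1) ≤ m applies; if `b < j`, the one for n does. Otherwise a
-- + b ≥ i + j = k.
balanced-size-bound : ∀ {n m a b k} → Balanced n m k → Feasible n m a b → k ≤ a + b
balanced-size-bound {a = a} {b} (i , j , refl , (m≥ , _) , (n≥ , _)) F
  with i ≤? a | j ≤? b
... | no  i≰a | _       = size-bound F (≰⇒≤∸1 i≰a) m≥
... | yes _   | no  j≰b = subst (i + j ≤_) (+-comm b a) (size-bound (Feasible-swap F) (≰⇒≤∸1 j≰b) n≥)
... | yes i≤a | yes j≤b = +-mono-≤ i≤a j≤b

-- For tight `n` the optimum is the whole part of size n with k - n further vertices. For `n ≤ 2`
-- the equation says m = k, and the part of size m suffices because n < m gives n ≤ C(m, 2).
extremal⇒minimal : ∀ {n m k} → 1 ≤ n → Extremal n m k → Minimal n m k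
extremal⇒minimal {n} {m} {k} 1≤n (n<k , m≡) =
  witness (tight-or-small n) , λ a b F → size-bound F (Feasible.a≤n F) (≤-reflexive (sym m≡))
  where
  witness : Tight n ⊎ n ≤ 2 → ∃[ a ] ∃[ b ] Feasible n m a b × a + b ≡ k
  witness (inj₁ t) with b , refl ← m≤n⇒∃[o]m+o≡n (<⇒≤ n<k) =
    n , b , feasible ≤-refl b≤m (m≤m+n n _) (tight⇒≤ n b t (≤-reflexive m≡)) , refl
    where
    open ≤-Reasoning
    b≤m : b ≤ m
    b≤m = ≤-pred (begin
      suc b        ≤⟨ +-monoˡ-≤ b 1≤n ⟩
      n + b        ≤⟨ m≤m+n (n + b) (h n) ⟩
      n + b + h n  ≡⟨ m≡ ⟨
      suc m        ∎)
  witness (inj₂ n≤2) =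
    0 , m , ≤⇒feasible (<⇒≤C₂ (subst (n <_) (sym m≡k) n<k)) , m≡k
    where
    m≡k : m ≡ k
    m≡k = suc-injective (trans m≡ (trans (cong (k +_) (≤2⇒h≡1 n≤2)) (+-comm k 1)))

-- For positive `n` this excludes (1, 1) and (2, 2) together.
Unexceptional : ℕ → ℕ → Set
Unexceptional n m = n ≡ m → n ≤ 2 → n ≡ 0

Unexceptional-swap : ∀ {n m} → Unexceptional n m → Unexceptional m n
Unexceptional-swap u refl = u refl

-- f(k, i) ≥ k.
h-bound⇒≤ : ∀ {k m} i → k + h i ≤ suc m → k ≤ m
h-bound⇒≤ {k} i k≤ = ≤-pred (≤-trans (subst (_≤ k + h i) (+-comm k 1) (+-monoʳ-≤ k (1≤h i))) k≤)

h-bound⇒≥ : ∀ {k m i} → i ≤ 2 → m < k + h i → m ≤ k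
h-bound⇒≥ {k} {m} i≤2 m< =
  ≤-pred (subst (m <_) (trans (cong (k +_) (≤2⇒h≡1 i≤2)) (+-comm k 1)) m<)

-- As f(k, i) = k for `i ≤ 2`, here m = k and the part of size m is taken whole. For tight `k`, n ≤
-- f(k, j) ≤ f(k, k) yields n ≤ C(k, 2); for `k ≤ 2` also n = k, an excluded case.
balanced-small⇒feasible : ∀ {n m k} → 1 ≤ n → Unexceptional n m →
  ((i , _) : Balanced n m k) → i ≤ 2 → Feasible n m 0 k
balanced-small⇒feasible {n} {m} {k} 1≤n u (i , j , i+j≡k , (m≥ , m<) , (n≥ , n<)) i≤2
  with ≤-antisym (h-bound⇒≥ i≤2 m<) (h-bound⇒≤ (i ∸ 1) m≥)
... | refl with tight-or-small k
...   | inj₁ t = ≤⇒feasible (tight⇒≤ k 0 t (≤-trans n<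
                   (+-mono-≤ (m≤m+n k 0) (h-mono (subst (j ≤_) i+j≡k (m≤n+m j i))))))
...   | inj₂ k≤2 = contradiction (u n≡k (subst (_≤ 2) (sym n≡k) k≤2)) (>⇒≢ 1≤n)
  where
  n≡k : n ≡ k
  n≡k = ≤-antisym
    (h-bound⇒≥ (≤-trans (subst (j ≤_) i+j≡k (m≤n+m j i)) k≤2) n<)
    (h-bound⇒≤ (j ∸ 1) n≥)

-- The pair (i, j) is feasible when both indices are tight; when one is 1 or 2, all k vertices are
-- taken from a single part instead.
balanced⇒minimal : ∀ {n m k} → 1 ≤ n → 1 ≤ m → Unexceptional n m →
  Balanced n m k → Minimal n m k
balanced⇒minimal {n} {m} {k} 1≤n 1≤m u B@(i , j , i+j≡k , (m≥ , m<) , (n≥ , n<)) =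
  witness (tight-or-small i) (tight-or-small j) , λ a b → balanced-size-bound B
  where
  witness : Tight i ⊎ i ≤ 2 → Tight j ⊎ j ≤ 2 → ∃[ a ] ∃[ b ] Feasible n m a b × a + b ≡ k
  witness (inj₂ i≤2) _ = 0 , k , balanced-small⇒feasible 1≤n u B i≤2 , refl
  witness (inj₁ _) (inj₂ j≤2) =
    k , 0 , Feasible-swap (balanced-small⇒feasible 1≤m (Unexceptional-swap u) (Balanced-swap B) j≤2)
    , +-identityʳ k
  witness (inj₁ ti) (inj₁ tj) = i , j , tight⇒feasible ti tj
    (≤-trans (m≤m+n i j) (i+j≤ (h-bound⇒≤ (j ∸ 1) n≥)))
    (≤-trans (m≤n+m j i) (i+j≤ (h-bound⇒≤ (i ∸ 1) m≥)))
    (subst (λ s → m < s + h i) (sym i+j≡k) m<)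
    (subst (λ s → n < s + h j) (sym i+j≡k) n<) , i+j≡k
    where
    i+j≤ : ∀ {p} → k ≤ p → i + j ≤ p
    i+j≤ = subst (_≤ _) (sym i+j≡k)

-- From least sizes to the conditions on f

small-part⇒extremal : ∀ {n m k} → 1 ≤ n → 1 ≤ m → Unexceptional n m →
  Minimal n m k → n < k → Extremal n m k
small-part⇒extremal {n} {m} {k} 1≤n 1≤m u ((a , b , F , refl) , least) n<k =
  n<k , ≤-antisym
    (≤-trans (feasible⇒< F) (+-monoʳ-≤ k (h-mono (Feasible.a≤n F))))
    (lower (tight-or-small n))
  where
  n≤C₂m : n ≤ 2 → n ≤ m C 2
  n≤C₂m n≤2 with n <? m
  ... | yes n<m = <⇒≤C₂ n<m
  ... | no  n≮m with m≤n⇒m<n∨m≡n (≮⇒≥ n≮m)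
  ...   | inj₂ refl = contradiction (u refl n≤2) (>⇒≢ 1≤n)
  -- Here the whole part of size n would be a feasible choice with fewer than k vertices.
  ...   | inj₁ m<n = contradiction (subst (k ≤_) (+-identityʳ n)
                       (least n 0 (Feasible-swap (≤⇒feasible (<⇒≤C₂ m<n))))) (<⇒≱ n<k)

  lower : Tight n ⊎ n ≤ 2 → k + h n ≤ suc m
  lower (inj₂ n≤2) rewrite ≤2⇒h≡1 n≤2 | +-comm k 1 =
    s≤s (least 0 m (≤⇒feasible (n≤C₂m n≤2)))
  -- With c = k - n - 1, failure of the bound would make (n, c) feasible, although its size is k -
  -- 1.
  lower (inj₁ t) with m≤n⇒∃[o]m+o≡n n<k
  ... | c , 1+n+c≡k = ≮⇒≥ λ m+1< → <⇒≱ (≤-reflexive 1+n+c≡k) (least n c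
          (feasible ≤-refl (<⇒≤ c<m) (m≤m+n n _)
            (tight⇒≤ n c t (≤-pred (subst (λ s → suc m < s + h n) (sym 1+n+c≡k) m+1<)))))
    where
    c<m : c < m
    c<m = +-cancelˡ-≤ n (suc c) m (begin
      n + suc c    ≡⟨ +-suc n c ⟩
      suc n + c    ≡⟨ 1+n+c≡k ⟩
      k            ≤⟨ least n m (feasible ≤-refl ≤-refl (m≤m+n n _) (m≤m+n m _)) ⟩
      n + m        ∎)
      where open ≤-Reasoning

large-parts⇒balanced : ∀ {n m k} → Minimal n m k → k ≤ n → k ≤ m → Balanced n m k
large-parts⇒balanced {n} {m} {k} ((a , b , F , a+b≡k) , least) k≤n k≤m =
  search 0 k refl k+1≤m (≤-trans n<k+hb (+-monoʳ-≤ k (h-mono (subst (b ≤_) a+b≡k (m≤n+m b a)))))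
  where
  k+1≤m : k + 1 ≤ suc m
  k+1≤m rewrite +-comm k 1 = s≤s k≤m

  k+1≤n : k + 1 ≤ suc n
  k+1≤n rewrite +-comm k 1 = s≤s k≤n

  n<k+hb : n < k + h b
  n<k+hb = subst (λ s → n < s + h b) (trans (+-comm b a) a+b≡k) (feasible⇒< (Feasible-swap F))

  m<k+h : ∀ {i} → a ≤ i → m < k + h i
  m<k+h {i} a≤i = ≤-trans (subst (λ s → m < s + h a) a+b≡k (feasible⇒< F)) (+-monoʳ-≤ k (h-mono a≤i))

  -- The hypotheses force h i > 1, which is impossible for `i ≤ 2`.
  tight : ∀ {i p} → k ≤ p → suc p < k + h i → Tight i
  tight {i} k≤p p+1< with tight-or-small i
  ... | inj₁ t = t
  ... | inj₂ i≤2 = contradiction (h-bound⇒≥ {k} i≤2 p+1<) (<⇒≱ (s≤s k≤p))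

  -- The largest i satisfying the two inequalities that are inherited by smaller i.
  search : ∀ i j → i + j ≡ k → k + h (i ∸ 1) ≤ suc m → n < k + h j → Balanced n m k
  search i zero i≡k m≥ n< = i , 0 , i≡k ,
    (m≥ , m<k+h (subst (a ≤_) (trans a+b≡k (trans (sym i≡k) (+-identityʳ i))) (m≤m+n a b))) , (k+1≤n , n<)
  search i (suc j) i+j≡k m≥ n< with k + h i ≤? suc m | n <? k + h j
  ... | yes m≥′ | yes n<′ = search (suc i) j (trans (sym (+-suc i j)) i+j≡k) m≥′ n<′
  -- The search stops because n > f(k, j). The optimum satisfies n ≤ f(k, b), so b > j and hence a ≤
  -- i, which bounds m from above.
  ... | _ | no n≮ = i , suc j , i+j≡k , (m≥ , m<k+h a≤i) , (m≤n⇒m≤1+n (≮⇒≥ n≮) , n<)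
    where
    j<b : j < b
    j<b = ≰⇒> λ b≤j → n≮ (≤-trans n<k+hb (+-monoʳ-≤ k (h-mono b≤j)))

    a≤i : a ≤ i
    a≤i = +-cancelʳ-≤ (suc j) a i (begin
      a + suc j  ≤⟨ +-monoʳ-≤ a j<b ⟩
      a + b      ≡⟨ trans a+b≡k (sym i+j≡k) ⟩
      i + suc j  ∎)
      where open ≤-Reasoning
  -- The search stops because m < f(k, i). If also n < f(k, j), both indices would be tight and (i,
  -- j) a feasible pair of size k - 1.
  ... | no m≱ | yes n<′ = i , suc j , i+j≡k , (m≥ , <⇒≤ m+1<) , (≮⇒≥ n+1≮ , n<)
    where
    m+1< : suc m < k + h i
    m+1< = ≰⇒> m≱

    1+i+j≡k : suc (i + j) ≡ k
    1+i+j≡k = trans (sym (+-suc i j)) i+j≡k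

    i+j≤k : i + j ≤ k
    i+j≤k = subst (i + j ≤_) 1+i+j≡k (n≤1+n (i + j))

    n+1≮ : ¬ suc n < k + h j
    n+1≮ n+1< = <⇒≱ (≤-reflexive 1+i+j≡k) (least i j (tight⇒feasible
      (tight {i} k≤m m+1<) (tight {j} k≤n n+1<)
      (≤-trans (≤-trans (m≤m+n i j) i+j≤k) k≤n)
      (≤-trans (≤-trans (m≤n+m j i) i+j≤k) k≤m)
      (≤-pred (subst (λ s → suc m < s + h i) (sym 1+i+j≡k) m+1<))
      (≤-pred (subst (λ s → suc n < s + h j) (sym 1+i+j≡k) n+1<))))

minimal⇒extremal⊎balanced : ∀ {n m k} → 1 ≤ n → 1 ≤ m → Unexceptional n m → Minimal n m k →
  Extremal n m k ⊎ Extremal m n k ⊎ Balanced n m k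
minimal⇒extremal⊎balanced {n} {m} {k} 1≤n 1≤m u M with n <? k | m <? k
... | yes n<k | _       = inj₁ (small-part⇒extremal 1≤n 1≤m u M n<k)
... | no  _   | yes m<k =
  inj₂ (inj₁ (small-part⇒extremal 1≤m 1≤n (Unexceptional-swap u) (Minimal-swap M) m<k))
... | no  n≮k | no  m≮k = inj₂ (inj₂ (large-parts⇒balanced M (≮⇒≥ n≮k) (≮⇒≥ m≮k)))

extremal⊎balanced⇒minimal : ∀ {n m k} → 1 ≤ n → 1 ≤ m → Unexceptional n m →
  Extremal n m k ⊎ Extremal m n k ⊎ Balanced n m k → Minimal n m k
extremal⊎balanced⇒minimal 1≤n 1≤m u (inj₁ E)        = extremal⇒minimal 1≤n E
extremal⊎balanced⇒minimal 1≤n 1≤m u (inj₂ (inj₁ E)) = Minimal-swap (extremal⇒minimal 1≤m E)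
extremal⊎balanced⇒minimal 1≤n 1≤m u (inj₂ (inj₂ B)) = balanced⇒minimal 1≤n 1≤m u B

-- Counting the elements and pairs of a subset

elements : ∀ {n} → Subset n → List (Fin n)
elements []          = []
elements (false ∷ S) = List.map suc (elements S)
elements (true ∷ S)  = zero ∷ List.map suc (elements S)

-- Each unordered pair is listed once, smaller element first, as in `Selection`.
pairs : ∀ {n} → Subset n → List (Fin n × Fin n)
pairs []          = []
pairs (false ∷ S) = List.map (Product.map suc suc) (pairs S)
pairs (true ∷ S)  =
  List.map (λ y → zero , suc y) (elements S) List.++ List.map (Product.map suc suc) (pairs S)

length-elements : ∀ {n} (S : Subset n) → List.length (elements S) ≡ ∣ S ∣
length-elements []          = refl
length-elements (false ∷ S) = trans (length-map suc (elements S)) (length-elements S)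
length-elements (true ∷ S)  = cong suc (trans (length-map suc (elements S)) (length-elements S))

length-pairs : ∀ {n} (S : Subset n) → List.length (pairs S) ≡ ∣ S ∣ C 2
length-pairs []          = refl
length-pairs (false ∷ S) = trans (length-map _ (pairs S)) (length-pairs S)
length-pairs (true ∷ S)  = begin
  List.length (pairs (true ∷ S))                     ≡⟨ length-++ (List.map _ (elements S)) ⟩
  List.length (List.map _ (elements S)) + List.length (List.map _ (pairs S))
    ≡⟨ cong₂ _+_ (trans (length-map _ (elements S)) (length-elements S))
                 (trans (length-map _ (pairs S)) (length-pairs S)) ⟩
  ∣ S ∣ + ∣ S ∣ C 2                                  ≡⟨ pascal₂ ∣ S ∣ ⟨
  suc ∣ S ∣ C 2                                      ∎
  where open ≡-Reasoning

∈-elements : ∀ {n x} {S : Subset n} → x ∈ S → x ∈ˡ elements S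
∈-elements here                      = here refl
∈-elements {S = false ∷ S} (there p) = ∈-map⁺ suc (∈-elements p)
∈-elements {S = true ∷ S}  (there p) = there (∈-map⁺ suc (∈-elements p))

∈-pairs : ∀ {n x y} {S : Subset n} → x ∈ S → y ∈ S → x Fin.< y → (x , y) ∈ˡ pairs S
∈-pairs here (there q) _ = ∈-++⁺ˡ (∈-map⁺ _ (∈-elements q))
∈-pairs {S = false ∷ S} (there p) (there q) (s≤s x<y) = ∈-map⁺ _ (∈-pairs p q x<y)
∈-pairs {S = true ∷ S}  (there p) (there q) (s≤s x<y) =
  ∈-++⁺ʳ (List.map _ (elements S)) (∈-map⁺ _ (∈-pairs p q x<y))

-- Pigeonhole principle: sending each `u` to the position of an entry related to it is injective, as
-- an entry determines `u`.
≤-length : ∀ {n} {A : Set} {xs : List A} (R : Fin n → A → Set) →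
  (∀ u → Any (R u) xs) → (∀ {u v a} → R u a → R v a → u ≡ v) → n ≤ List.length xs
≤-length {xs = xs} R total injective = injective⇒≤ {f = λ u → Any.index (total u)} λ {u} {v} eq →
  injective (lookup-index (total u))
    (subst (λ i → R v (List.lookup xs i)) (sym eq) (lookup-index (total v)))

-- Subsets of a disjoint union, and initial segments

∈-++ˡ : ∀ {n m} {A : Subset n} {B : Subset m} {u} → u ∈ A → u ↑ˡ m ∈ A ++ B
∈-++ˡ {A = A} {B} {u} p = lookup⇒[]= _ _ (trans (lookup-++ˡ A B u) ([]=⇒lookup p))

∈-++ʳ : ∀ {n m} {A : Subset n} {B : Subset m} {w} → w ∈ B → n ↑ʳ w ∈ A ++ B
∈-++ʳ {A = A} {B} {w} p = lookup⇒[]= _ _ (trans (lookup-++ʳ A B w) ([]=⇒lookup p))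

∈-++ˡ⁻ : ∀ {n m} {A : Subset n} {B : Subset m} {u} → u ↑ˡ m ∈ A ++ B → u ∈ A
∈-++ˡ⁻ {A = A} {B} {u} p = lookup⇒[]= _ _ (trans (sym (lookup-++ˡ A B u)) ([]=⇒lookup p))

∈-++ʳ⁻ : ∀ {n m} {A : Subset n} {B : Subset m} {w} → n ↑ʳ w ∈ A ++ B → w ∈ B
∈-++ʳ⁻ {A = A} {B} {w} p = lookup⇒[]= _ _ (trans (sym (lookup-++ʳ A B w)) ([]=⇒lookup p))

∣++∣ : ∀ {n m} (A : Subset n) (B : Subset m) → ∣ A ++ B ∣ ≡ ∣ A ∣ + ∣ B ∣
∣++∣ []          B = refl
∣++∣ (false ∷ A) B = ∣++∣ A B
∣++∣ (true ∷ A)  B = cong suc (∣++∣ A B)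

prefix : ∀ n → ℕ → Subset n
prefix zero    a       = []
prefix (suc n) zero    = false ∷ prefix n zero
prefix (suc n) (suc a) = true ∷ prefix n a

∣prefix∣ : ∀ {n a} → a ≤ n → ∣ prefix n a ∣ ≡ a
∣prefix∣ {zero}  z≤n       = refl
∣prefix∣ {suc n} z≤n       = ∣prefix∣ {n} z≤n
∣prefix∣         (s≤s a≤n) = cong suc (∣prefix∣ a≤n)

∈-prefix : ∀ {n a} {u : Fin n} → toℕ u < a → u ∈ prefix n a
∈-prefix {suc n} {suc a} {zero}  _         = here
∈-prefix {suc n} {suc a} {suc u} (s≤s u<a) = there (∈-prefix u<a)

-- Shortest paths in graphs of diameter at most two

module _ {N} (G : Graph N) where
  open Graph G

  start-∈ : ∀ {x y} (w : Walk x y) → x ∈ˡ vertices w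
  start-∈ ε       = here refl
  start-∈ (_ ◅ _) = here refl

  end-∈ : ∀ {x y} (w : Walk x y) → y ∈ˡ vertices w
  end-∈ ε       = here refl
  end-∈ (_ ◅ w) = there (end-∈ w)

  CoveredBy : ∀ {S} → Selection S → Fin N → Set
  CoveredBy {S} g v =
    ∃[ x ] ∃[ y ] Σ[ x∈S ∈ x ∈ S ] Σ[ y∈S ∈ y ∈ S ] Σ[ x<y ∈ x Fin.< y ]
      v ∈ˡ vertices (walk (g x y x∈S y∈S x<y))

  endpoints-covered : ∀ {S} (g : Selection S) {v v′} → v ∈ S → v′ ∈ S → v ≢ v′ → CoveredBy g v
  endpoints-covered g {v} {v′} p q v≢v′ with Fin.<-cmp v v′
  ... | tri< lt _ _ = v , v′ , p , q , lt , start-∈ _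
  ... | tri≈ _ eq _ = contradiction eq v≢v′
  ... | tri> _ _ gt = v′ , v , q , p , gt , end-∈ _

  -- A walk this short has room for one inner vertex. The full vertex list is recorded so that this
  -- vertex can be recovered from the walk.
  interior : ∀ {x y v} (w : Walk x y) → length w ≤ 2 → v ∈ˡ vertices w →
    v ≡ x ⊎ v ≡ y ⊎ (Adj x v × Adj v y × vertices w ≡ x ∷ v ∷ y ∷ [])
  interior ε           _ (here v≡)                 = inj₁ v≡
  interior (_ ◅ _)     _ (here v≡)                 = inj₁ v≡
  interior (_ ◅ ε)     _ (there (here v≡))         = inj₂ (inj₁ v≡)
  interior (a ◅ b ◅ ε) _ (there (here refl))       = inj₂ (inj₂ (a , b , refl))
  interior (_ ◅ _ ◅ ε) _ (there (there (here v≡))) = inj₂ (inj₁ v≡)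
  interior (_ ◅ _ ◅ _ ◅ _) (s≤s (s≤s ())) _

  edge-path : ∀ {x y} → Adj x y → ShortestPath x y
  edge-path {x} a = record
    { walk     = a ◅ ε
    ; isPath   = ((λ x≡y → irrefl (subst (Adj x) (sym x≡y) a)) ∷ []) ∷ [] ∷ []
    ; shortest = λ { ε _ → ⊥-elim (irrefl a) ; (_ ◅ _) _ → s≤s z≤n }
    }

  -- The inequality is irrelevant because it will come from the irrelevant `x < y` of a selection.
  hub-path : ∀ {x y z} → .(x ≢ y) → ¬ Adj x y → Adj x z → Adj z y → ShortestPath x y
  hub-path {x} {y} {z} x≢y ¬a a b = record
    { walk     = a ◅ b ◅ ε
    ; isPath   = ((λ x≡z → irrefl (subst (Adj x) (sym x≡z) a)) ∷ (λ x≡y → ⊥-elim-irr (x≢y x≡y)) ∷ [])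
               ∷ ((λ z≡y → irrefl (subst (Adj z) (sym z≡y) b)) ∷ []) ∷ [] ∷ []
    ; shortest = λ { ε _ → ⊥-elim-irr (x≢y refl) ; (c ◅ ε) _ → ⊥-elim (¬a c)
                   ; (_ ◅ _ ◅ _) _ → s≤s (s≤s z≤n) }
    }

  -- A choice of common neighbours for nonadjacent vertices serves two purposes: it defines a
  -- selection with prescribed midpoints, and it bounds the length of every shortest path.
  module Hubs (hub : Fin N → Fin N → Fin N)
              (hub-adj : ∀ x y → ¬ Adj x y → Adj x (hub x y) × Adj (hub x y) y) where

    short-path : ∀ x y → .(x ≢ y) → Dec (Adj x y) → ShortestPath x y
    short-path x y x≢y (yes a) = edge-path a
    short-path x y x≢y (no ¬a) = hub-path x≢y ¬a (proj₁ (hub-adj x y ¬a)) (proj₂ (hub-adj x y ¬a))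

    selection : ∀ S → Selection S
    selection S x y _ _ x<y = short-path x y (Fin.<⇒≢ x<y) (adj? x y)

    hub-∈ : ∀ {S x y} (x∈S : x ∈ S) (y∈S : y ∈ S) (x<y : x Fin.< y) → ¬ Adj x y →
      hub x y ∈ˡ vertices (walk (selection S x y x∈S y∈S x<y))
    hub-∈ {x = x} {y} _ _ _ ¬a with adj? x y
    ... | yes a = contradiction a ¬a
    ... | no _  = there (here refl)

    length≤2 : ∀ {x y} → x ≢ y → (p : ShortestPath x y) → length (walk p) ≤ 2
    length≤2 {x} {y} x≢y p = ≤-trans (shortest p (walk q) (isPath q)) (short (adj? x y))
      where
      q = short-path x y x≢y (adj? x y)
      short : ∀ d → length (walk (short-path x y x≢y d)) ≤ 2
      short (yes _) = s≤s z≤n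
      short (no _)  = ≤-refl

  -- A vertex of the part embedded by `e` lies in S or is the midpoint of a selected path between
  -- two vertices of S in the other part. Each such path has one midpoint, so the vertices inject
  -- into the elements of `A` and the pairs of `B`.
  side-bound : ∀ {p q S} {A : Subset p} {B : Subset q}
    (g : Selection S) → Covers g →
    (∀ {x y} → x ≢ y → (p : ShortestPath x y) → length (walk p) ≤ 2) →
    (e : Fin p → Fin N) (e′ : Fin q → Fin N) →
    (∀ {u v} → e u ≡ e v → u ≡ v) →
    (∀ {u v} → e′ u Fin.< e′ v → u Fin.< v) →
    (∀ {u} → e u ∈ S → u ∈ A) → (∀ {w} → e′ w ∈ S → w ∈ B) →
    (∀ {u y} → Adj (e u) y → ∃[ w ] y ≡ e′ w) →
    p ≤ ∣ A ∣ + ∣ B ∣ C 2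
  side-bound {p} {q} {S} {A} {B} g cov diameter e e′ e-inj e′-cancel-< ∈A ∈B neighbour =
    subst (p ≤_) length-codes (≤-length Covered covered Covered-injective)
    where
    Code : Set
    Code = Fin p ⊎ (Fin q × Fin q)

    codes : List Code
    codes = List.map inj₁ (elements A) List.++ List.map inj₂ (pairs B)

    length-codes : List.length codes ≡ ∣ A ∣ + ∣ B ∣ C 2
    length-codes = trans (length-++ (List.map inj₁ (elements A)))
      (cong₂ _+_ (trans (length-map inj₁ (elements A)) (length-elements A))
                 (trans (length-map inj₂ (pairs B)) (length-pairs B)))

    Covered : Fin p → Code → Set
    Covered u (inj₁ v)        = u ≡ v
    Covered u (inj₂ (w , w′)) =
      Σ[ r ∈ e′ w ∈ S ] Σ[ s ∈ e′ w′ ∈ S ] Σ[ t ∈ e′ w Fin.< e′ w′ ]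
        vertices (walk (g (e′ w) (e′ w′) r s t)) ≡ e′ w ∷ e u ∷ e′ w′ ∷ []

    Covered-injective : ∀ {u v c} → Covered u c → Covered v c → u ≡ v
    Covered-injective {c = inj₁ _} refl refl = refl
    -- Both equations concern the same path, since a selection ignores the proofs of membership and
    -- order.
    Covered-injective {c = inj₂ _} (_ , _ , _ , eq) (_ , _ , _ , eq′) =
      e-inj (∷-injectiveˡ (∷-injectiveʳ (trans (sym eq) eq′)))

    inside-code : ∀ {u} → e u ∈ S → Any (Covered u) codes
    inside-code r = lose (∈-++⁺ˡ (∈-map⁺ inj₁ (∈-elements (∈A r)))) refl

    covered : ∀ u → Any (Covered u) codes
    covered u with cov (e u)
    ... | x , y , r , s , t , v∈ with interior (walk (g x y r s t)) (diameter (Fin.<⇒≢ t) (g x y r s t)) v∈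
    ...   | inj₁ v≡x = inside-code (subst (_∈ S) (sym v≡x) r)
    ...   | inj₂ (inj₁ v≡y) = inside-code (subst (_∈ S) (sym v≡y) s)
    -- Both ends are adjacent to `e u`, so they lie in the other part.
    ...   | inj₂ (inj₂ (a , b , eq)) with neighbour (symm a) | neighbour b
    ...     | w , refl | w′ , refl = lose
              (∈-++⁺ʳ (List.map inj₁ (elements A))
                (∈-map⁺ inj₂ (∈-pairs (∈B r) (∈B s) (e′-cancel-< t))))
              (r , s , t , eq)

-- Adjacency and common neighbours in K(n, m)

module _ (n m : ℕ) where
  open Graph (K n m)

  left-right-adj : ∀ u w → Adj (u ↑ˡ m) (n ↑ʳ w)
  left-right-adj u w rewrite splitAt-↑ˡ n u m | splitAt-↑ʳ n m w = tt

  left-neighbour : ∀ {u y} → Adj (u ↑ˡ m) y → ∃[ w ] y ≡ n ↑ʳ w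
  left-neighbour {u} {y} a rewrite splitAt-↑ˡ n u m with splitAt n y in eq
  ... | inj₂ w = w , sym (splitAt⁻¹-↑ʳ eq)

  right-neighbour : ∀ {w y} → Adj (n ↑ʳ w) y → ∃[ u ] y ≡ u ↑ˡ m
  right-neighbour {w} {y} a rewrite splitAt-↑ʳ n m w with splitAt n y in eq
  ... | inj₁ u = u , sym (splitAt⁻¹-↑ˡ eq)

  left-independent : ∀ u v → ¬ Adj (u ↑ˡ m) (v ↑ˡ m)
  left-independent u v a rewrite splitAt-↑ˡ n u m | splitAt-↑ˡ n v m = a

  right-independent : ∀ u v → ¬ Adj (n ↑ʳ u) (n ↑ʳ v)
  right-independent u v a rewrite splitAt-↑ʳ n m u | splitAt-↑ʳ n m v = a

  -- The value for vertices on opposite sides is never used.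
  hub : (Fin n → Fin n → Fin m) → (Fin m → Fin m → Fin n) →
    Fin (n + m) → Fin (n + m) → Fin (n + m)
  hub α β x y with splitAt n x | splitAt n y
  ... | inj₁ u | inj₁ v = n ↑ʳ α u v
  ... | inj₂ u | inj₂ v = β u v ↑ˡ m
  ... | _      | _      = x

  hub-adj : ∀ α β x y → ¬ Adj x y → Adj x (hub α β x y) × Adj (hub α β x y) y
  hub-adj α β x y ¬a with splitAt n x | splitAt n y
  ... | inj₁ u | inj₁ v rewrite splitAt-↑ʳ n m (α u v) = tt , tt
  ... | inj₂ u | inj₂ v rewrite splitAt-↑ˡ n (β u v) m = tt , tt
  ... | inj₁ _ | inj₂ _ = contradiction tt ¬a
  ... | inj₂ _ | inj₁ _ = contradiction tt ¬a

  hub-left : ∀ α β u v → hub α β (u ↑ˡ m) (v ↑ˡ m) ≡ n ↑ʳ α u v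
  hub-left α β u v rewrite splitAt-↑ˡ n u m | splitAt-↑ˡ n v m = refl

  hub-right : ∀ α β u v → hub α β (n ↑ʳ u) (n ↑ʳ v) ≡ β u v ↑ˡ m
  hub-right α β u v rewrite splitAt-↑ʳ n m u | splitAt-↑ʳ n m v = refl

-- Vertex order within the parts

↑ˡ-mono-< : ∀ {n m} {u v : Fin n} → u Fin.< v → u ↑ˡ m Fin.< v ↑ˡ m
↑ˡ-mono-< {m = m} {u} {v} = subst₂ _<_ (sym (toℕ-↑ˡ u m)) (sym (toℕ-↑ˡ v m))

↑ˡ-cancel-< : ∀ {n m} {u v : Fin n} → u ↑ˡ m Fin.< v ↑ˡ m → u Fin.< v
↑ˡ-cancel-< {m = m} {u} {v} = subst₂ _<_ (toℕ-↑ˡ u m) (toℕ-↑ˡ v m)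

↑ʳ-mono-< : ∀ {n m} {u v : Fin m} → u Fin.< v → n ↑ʳ u Fin.< n ↑ʳ v
↑ʳ-mono-< {n} {u = u} {v} u<v =
  subst₂ _<_ (sym (toℕ-↑ʳ n u)) (sym (toℕ-↑ʳ n v)) (+-monoʳ-< n u<v)

↑ʳ-cancel-< : ∀ {n m} {u v : Fin m} → n ↑ʳ u Fin.< n ↑ʳ v → u Fin.< v
↑ʳ-cancel-< {n} {u = u} {v} lt =
  +-cancelˡ-< n (toℕ u) (toℕ v) (subst₂ _<_ (toℕ-↑ʳ n u) (toℕ-↑ʳ n v) lt)

-- Assigning pairs to the vertices they cover

-- C(y, 2) + x enumerates the pairs x < y < b by the numbers below C(b, 2).
pair-with-rank : ∀ {t} b → t < b C 2 → ∃[ x ] ∃[ y ] x < y × y < b × y C 2 + x ≡ t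
pair-with-rank {t} (suc b) t< with t <? b C 2
... | yes t<′ with pair-with-rank b t<′
...   | x , y , x<y , y<b , eq = x , y , x<y , m≤n⇒m≤1+n y<b , eq
pair-with-rank {t} (suc b) t< | no t≮ with m≤n⇒∃[o]m+o≡n (≮⇒≥ t≮)
... | x , refl = x , b ,
      +-cancelˡ-< (b C 2) x b (subst (t <_) (trans (pascal₂ b) (+-comm b (b C 2))) t<) ,
      ≤-refl , refl

-- The value zero for large ranks is never used.
slot : ∀ {p q} → ℕ → Fin q → Fin q → Fin (suc p)
slot {p} a x y with a + (toℕ y C 2 + toℕ x) <? suc p
... | yes lt = fromℕ< lt
... | no  _  = zero

slot-≡ : ∀ {p q} a (x y : Fin q) (u : Fin (suc p)) →
  a + (toℕ y C 2 + toℕ x) ≡ toℕ u → slot a x y ≡ u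
slot-≡ {p} a x y u eq with a + (toℕ y C 2 + toℕ x) <? suc p
... | yes lt = toℕ-injective (trans (toℕ-fromℕ< lt) eq)
... | no  ≮p = contradiction (subst (_< suc p) (sym eq) (toℕ<n u)) ≮p

-- At most C(b, 2) vertices follow the first `a`, so u - a is the rank of a pair below `b`.
pair-with-slot : ∀ {p q a b} (u : Fin (suc p)) → a ≤ toℕ u → suc p ≤ a + b C 2 → b ≤ q →
  ∃[ x ] ∃[ y ] x Fin.< y × toℕ y < b × slot {q = q} a x y ≡ u
pair-with-slot {p} {q} {a} {b} u a≤u p≤ b≤q with m≤n⇒∃[o]m+o≡n a≤u
... | t , a+t≡u with pair-with-rank b
                       (+-cancelˡ-< a t (b C 2) (subst (_< a + b C 2) (sym a+t≡u) (≤-trans (toℕ<n u) p≤)))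
...   | x , y , x<y , y<b , refl =
        fromℕ< x<q , fromℕ< y<q ,
        subst₂ _<_ (sym toℕx) (sym toℕy) x<y ,
        subst (_< b) (sym toℕy) y<b ,
        slot-≡ a _ _ u (trans (cong₂ (λ i j → a + (i C 2 + j)) toℕy toℕx) a+t≡u)
  where
  y<q : y < q
  y<q = ≤-trans y<b b≤q
  x<q : x < q
  x<q = <-trans x<y y<q
  toℕx : toℕ (fromℕ< x<q) ≡ x
  toℕx = toℕ-fromℕ< x<q
  toℕy : toℕ (fromℕ< y<q) ≡ y
  toℕy = toℕ-fromℕ< y<q

-- Strong geodetic sets and feasible pairs

strongGeodetic⇒feasible : ∀ n m (S : Subset (suc n + suc m)) →
  Graph.IsStrongGeodetic (K (suc n) (suc m)) S →
  ∃[ a ] ∃[ b ] Feasible (suc n) (suc m) a b × a + b ≡ ∣ S ∣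
strongGeodetic⇒feasible n m S (inj₁ (1≡ , _)) =
  contradiction (suc-injective 1≡) λ eq → 1+n≢0 (trans (sym (+-suc n m)) eq)
strongGeodetic⇒feasible n m S (inj₂ (g , cov)) =
  ∣ A ∣ , ∣ B ∣ ,
  feasible (∣p∣≤n A) (∣p∣≤n B)
    (side-bound G g cov length≤2 (_↑ˡ suc m) (suc n ↑ʳ_) (↑ˡ-injective _ _ _)
      ↑ʳ-cancel-< ∈A ∈B (λ {u} → left-neighbour _ _ {u}))
    (side-bound G g cov length≤2 (suc n ↑ʳ_) (_↑ˡ suc m) (↑ʳ-injective (suc n) _ _)
      ↑ˡ-cancel-< ∈B ∈A (right-neighbour _ _)) ,
  trans (sym (∣++∣ A B)) (cong ∣_∣ (take++drop≡id (suc n) S))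
  where
  G : Graph (suc n + suc m)
  G = K (suc n) (suc m)
  -- Any common neighbours will do here, as they only serve to bound the lengths of shortest paths.
  α : Fin (suc n) → Fin (suc n) → Fin (suc m)
  α _ _ = zero
  β : Fin (suc m) → Fin (suc m) → Fin (suc n)
  β _ _ = zero
  open Hubs G (hub (suc n) (suc m) α β) (hub-adj (suc n) (suc m) α β)
  A : Subset (suc n)
  A = take (suc n) S
  B : Subset (suc m)
  B = drop (suc n) S
  split : S ≡ A ++ B
  split = sym (take++drop≡id (suc n) S)
  ∈A : ∀ {u} → u ↑ˡ suc m ∈ S → u ∈ A
  ∈A {u} = ∈-++ˡ⁻ ∘ subst (u ↑ˡ suc m ∈_) split
  ∈B : ∀ {w} → suc n ↑ʳ w ∈ S → w ∈ B
  ∈B {w} = ∈-++ʳ⁻ {A = A} ∘ subst (suc n ↑ʳ w ∈_) split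

feasible⇒strongGeodetic : ∀ {n m a b} → Feasible (suc n) (suc m) a b →
  ∃[ S ] Graph.IsStrongGeodetic (K (suc n) (suc m)) S × ∣ S ∣ ≡ a + b
feasible⇒strongGeodetic {n} {m} {a} {b} (feasible a≤n b≤m n≤ m≤) =
  S , inj₂ (g , cov) ,
  trans (∣++∣ (prefix (suc n) a) (prefix (suc m) b)) (cong₂ _+_ (∣prefix∣ a≤n) (∣prefix∣ b≤m))
  where
  G : Graph (suc n + suc m)
  G = K (suc n) (suc m)
  open Graph G

  S : Subset (suc n + suc m)
  S = prefix (suc n) a ++ prefix (suc m) b

  L : Fin (suc n) → Fin (suc n + suc m)
  L = _↑ˡ suc m

  R : Fin (suc m) → Fin (suc n + suc m)
  R = suc n ↑ʳ_

  L∈S : ∀ {u} → toℕ u < a → L u ∈ S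
  L∈S u<a = ∈-++ˡ (∈-prefix u<a)

  R∈S : ∀ {w} → toℕ w < b → R w ∈ S
  R∈S w<b = ∈-++ʳ {A = prefix (suc n) a} (∈-prefix w<b)

  h₀ : Fin (suc n + suc m) → Fin (suc n + suc m) → Fin (suc n + suc m)
  -- Left pairs cover the right vertices after the first `b`, and right pairs the left vertices
  -- after the first `a`.
  h₀ = hub (suc n) (suc m) (slot b) (slot a)

  open Hubs G h₀ (hub-adj (suc n) (suc m) (slot b) (slot a))

  g : Selection S
  g = selection S

  L≢R : ∀ u w → L u ≢ R w
  L≢R u w eq = irrefl {R w} (subst (λ x → Adj x (R w)) eq (left-right-adj (suc n) (suc m) u w))

  another : ∀ {p q} → p ∈ S → q ∈ S → p ≢ q → ∀ v → ∃[ v′ ] v′ ∈ S × v ≢ v′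
  another {p} {q} p∈S q∈S p≢q v with v Fin.≟ p
  ... | yes refl = q , q∈S , p≢q
  ... | no v≢p   = p , p∈S , v≢p

  -- Members of S are covered as endpoints, which takes a second member; the inequalities for
  -- positive parts rule out a + b ≤ 1.
  other : ∀ v → ∃[ v′ ] v′ ∈ S × v ≢ v′
  other = go a b a≤n b≤m n≤ m≤ L∈S R∈S
    where
    go : ∀ a b → a ≤ suc n → b ≤ suc m → suc n ≤ a + b C 2 → suc m ≤ b + a C 2 →
      (∀ {u} → toℕ u < a → L u ∈ S) → (∀ {w} → toℕ w < b → R w ∈ S) →
      ∀ v → ∃[ v′ ] v′ ∈ S × v ≢ v′
    go (suc _) (suc _) _ _ _ _ l r = another (l {zero} (s≤s z≤n)) (r {zero} (s≤s z≤n)) (L≢R zero zero)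
    go 0 0 _ _ () _ _ _
    go 0 1 _ _ () _ _ _
    go 1 0 _ _ _ () _ _
    go 0 (suc (suc _)) _ (s≤s (s≤s _)) _ _ _ r =
      another (r {zero} (s≤s z≤n)) (r {suc zero} (s≤s (s≤s z≤n)))
        λ eq → Fin.0≢1+n (↑ʳ-injective (suc n) _ _ eq)
    go (suc (suc _)) 0 (s≤s (s≤s _)) _ _ _ l _ =
      another (l {zero} (s≤s z≤n)) (l {suc zero} (s≤s (s≤s z≤n)))
        λ eq → Fin.0≢1+n (↑ˡ-injective (suc m) _ _ eq)

  cov-member : ∀ {v} → v ∈ S → CoveredBy G g v
  cov-member {v} v∈S with other v
  ... | v′ , v′∈S , v≢v′ = endpoints-covered G g v∈S v′∈S v≢v′

  cov : Covers g
  cov v with splitAt (suc n) v in eq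
  ... | inj₁ u with refl ← splitAt⁻¹-↑ˡ {suc n} {i = v} eq | toℕ u <? a
  ...   | yes u<a = cov-member (L∈S u<a)
  ...   | no  u≮a with pair-with-slot {b = b} u (≮⇒≥ u≮a) n≤ b≤m
  ...     | x , y , x<y , y<b , slot≡u =
            let x∈S = R∈S (<-trans x<y y<b); y∈S = R∈S y<b; x<y′ = ↑ʳ-mono-< x<y in
            R x , R y , x∈S , y∈S , x<y′ ,
            subst (_∈ˡ vertices (walk (g (R x) (R y) x∈S y∈S x<y′)))
              (trans (hub-right (suc n) (suc m) (slot b) (slot a) x y) (cong L slot≡u))
              (hub-∈ x∈S y∈S x<y′ (right-independent (suc n) (suc m) x y))
  cov v | inj₂ w with refl ← splitAt⁻¹-↑ʳ {suc n} {i = v} eq | toℕ w <? b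
  ...   | yes w<b = cov-member (R∈S w<b)
  ...   | no  w≮b with pair-with-slot {b = a} w (≮⇒≥ w≮b) m≤ a≤n
  ...     | x , y , x<y , y<a , slot≡w =
            let x∈S = L∈S (<-trans x<y y<a); y∈S = L∈S y<a; x<y′ = ↑ˡ-mono-< x<y in
            L x , L y , x∈S , y∈S , x<y′ ,
            subst (_∈ˡ vertices (walk (g (L x) (L y) x∈S y∈S x<y′)))
              (trans (hub-left (suc n) (suc m) (slot b) (slot a) x y) (cong R slot≡w))
              (hub-∈ x∈S y∈S x<y′ (left-independent (suc n) (suc m) x y))

sg⇒minimal : ∀ {n m k} → sg[ K (suc n) (suc m) ]≡ k → Minimal (suc n) (suc m) k
sg⇒minimal {n} {m} {k} ((S , sgS , ∣S∣≡k) , least) with strongGeodetic⇒feasible n m S sgS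
... | a , b , F , eq = (a , b , F , trans eq ∣S∣≡k) , λ a b F → bound (feasible⇒strongGeodetic F)
  where
  bound : ∀ {s} → ∃[ S ] Graph.IsStrongGeodetic (K (suc n) (suc m)) S × ∣ S ∣ ≡ s → k ≤ s
  bound (S , sgS , refl) = least S sgS

minimal⇒sg : ∀ {n m k} → Minimal (suc n) (suc m) k → sg[ K (suc n) (suc m) ]≡ k
minimal⇒sg {n} {m} {k} ((a , b , F , a+b≡k) , least) with feasible⇒strongGeodetic F
... | S , sgS , eq = (S , sgS , trans eq a+b≡k) , bound
  where
  bound : ∀ S → Graph.IsStrongGeodetic (K (suc n) (suc m)) S → k ≤ ∣ S ∣
  bound S sgS with strongGeodetic⇒feasible n m S sgS
  ... | a , b , F , eq = subst (k ≤_) eq (least a b F)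

-- The conditions in terms of integers

-- Imported only here because the prefix +_ makes sections of _+_ ambiguous.
open import Data.Integer as ℤ using (+_; 0ℤ; 1ℤ)
open import Data.Integer.Properties using (+-injective; drop‿+≤+; m-n≡m⊖n; ⊖-≥)

f-+ : ∀ k j → f (+ suc k) (+ j) ≡ + (k + h j)
f-+ k zero    = refl
f-+ k (suc j) = refl

-- Truncation is harmless at `j = 0`: the maximum in f is 2 both at -1 and at 0.
f-pred : ∀ k j → f (+ suc k) (+ j ℤ.- 1ℤ) ≡ + (k + h (j ∸ 1))
f-pred k zero    = refl
f-pred k (suc j) = f-+ k j

+-∸ : ∀ i j {k} → i + j ≡ k → + k ℤ.- + i ≡ + j
+-∸ i j refl = begin
  + (i + j) ℤ.- + i  ≡⟨ m-n≡m⊖n (i + j) i ⟩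
  (i + j) ℤ.⊖ i      ≡⟨ ⊖-≥ (m≤m+n i j) ⟩
  + (i + j ∸ i)      ≡⟨ cong +_ (m+n∸m≡n i j) ⟩
  + j                ∎
  where open ≡-Reasoning

ExtremalF : ℕ → ℕ → ℕ → Set
ExtremalF n m k = n < k × + m ≡ f (+ k) (+ n)

BalancedF : ℕ → ℕ → ℕ → Set
BalancedF n m k =
  ∃[ i ] (0ℤ ℤ.≤ i × i ℤ.≤ + k ×
    (f (+ k) (i ℤ.- 1ℤ) ℤ.≤ + m × + m ℤ.≤ f (+ k) i) ×
    (f (+ k) (+ k ℤ.- i ℤ.- 1ℤ) ℤ.≤ + n × + n ℤ.≤ f (+ k) (+ k ℤ.- i)))

extremal⇒ : ∀ {n m k} → Extremal n m (suc k) → ExtremalF n m (suc k)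
extremal⇒ {n} {m} {k} (n<k , eq) = n<k , trans (cong +_ (suc-injective eq)) (sym (f-+ k n))

extremal⇐ : ∀ {n m k} → ExtremalF n m (suc k) → Extremal n m (suc k)
extremal⇐ {n} {m} {k} (n<k , eq) = n<k , cong suc (+-injective (trans eq (f-+ k n)))

between⇒ : ∀ {k p} j → suc k + h (j ∸ 1) ≤ suc p × p < suc k + h j →
  f (+ suc k) (+ j ℤ.- 1ℤ) ℤ.≤ + p × + p ℤ.≤ f (+ suc k) (+ j)
between⇒ {k} {p} j (p≥ , p<) =
  subst (ℤ._≤ + p) (sym (f-pred k j)) (ℤ.+≤+ (≤-pred p≥)) ,
  subst (+ p ℤ.≤_) (sym (f-+ k j)) (ℤ.+≤+ (≤-pred p<))

between⇐ : ∀ {k p} j → f (+ suc k) (+ j ℤ.- 1ℤ) ℤ.≤ + p × + p ℤ.≤ f (+ suc k) (+ j) →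
  suc k + h (j ∸ 1) ≤ suc p × p < suc k + h j
between⇐ {k} {p} j (p≥ , p≤) =
  s≤s (drop‿+≤+ (subst (ℤ._≤ + p) (f-pred k j) p≥)) ,
  s≤s (drop‿+≤+ (subst (+ p ℤ.≤_) (f-+ k j) p≤))

balanced⇒ : ∀ {n m k} → Balanced n m (suc k) → BalancedF n m (suc k)
balanced⇒ {n} {m} {k} (i , j , i+j≡k , M , N) =
  + i , ℤ.+≤+ z≤n , ℤ.+≤+ (subst (i ≤_) i+j≡k (m≤m+n i j)) , between⇒ i M ,
  subst (λ z → f (+ suc k) (z ℤ.- 1ℤ) ℤ.≤ + n × + n ℤ.≤ f (+ suc k) z)
    (sym (+-∸ i j i+j≡k)) (between⇒ j N)

balanced⇐ : ∀ {n m k} → BalancedF n m (suc k) → Balanced n m (suc k)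
balanced⇐ {n} {m} {k} (+ i , _ , ℤ.+≤+ i≤k , M , N) =
  i , suc k ∸ i , i+j≡k , between⇐ i M ,
  between⇐ (suc k ∸ i)
    (subst (λ z → f (+ suc k) (z ℤ.- 1ℤ) ℤ.≤ + n × + n ℤ.≤ f (+ suc k) z) (+-∸ i (suc k ∸ i) i+j≡k) N)
  where
  i+j≡k : i + (suc k ∸ i) ≡ suc k
  i+j≡k = m+[n∸m]≡n i≤k

-- The exceptional cases and the conclusion

unexceptional : ∀ {n m} → (n , m) ≢ (1 , 1) → (n , m) ≢ (2 , 2) → Unexceptional n m
unexceptional ≢1 ≢2 refl z≤n             = refl
unexceptional ≢1 ≢2 refl (s≤s z≤n)       = contradiction refl ≢1
unexceptional ≢1 ≢2 refl (s≤s (s≤s z≤n)) = contradiction refl ≢2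

-- Condition (iii) holds here for k = 1, but a single vertex forms no pair.
minimal-1-1 : Minimal 1 1 2
minimal-1-1 = (1 , 1 , feasible ≤-refl ≤-refl ≤-refl ≤-refl , refl) , least
  where
  least : ∀ a b → Feasible 1 1 a b → 2 ≤ a + b
  least 0 0 (feasible _ _ () _)
  least 0 1 (feasible _ _ () _)
  least 1 0 (feasible _ _ _ ())
  least 1 1 _ = ≤-refl
  least (suc (suc _)) _ (feasible (s≤s ()) _ _ _)
  least _ (suc (suc _)) (feasible _ (s≤s ()) _ _)

-- Condition (iii) holds here for k = 2, but a single pair covers at most one further vertex.
minimal-2-2 : Minimal 2 2 3
minimal-2-2 = (2 , 1 , feasible ≤-refl (s≤s z≤n) ≤-refl ≤-refl , refl) , least
  where
  least : ∀ a b → Feasible 2 2 a b → 3 ≤ a + b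
  least 0 0 (feasible _ _ () _)
  least 0 1 (feasible _ _ () _)
  least 0 2 (feasible _ _ (s≤s ()) _)
  least 1 0 (feasible _ _ (s≤s ()) _)
  least 1 1 (feasible _ _ (s≤s ()) _)
  least 2 0 (feasible _ _ _ (s≤s ()))
  least 1 2 _ = ≤-refl
  least 2 1 _ = ≤-refl
  least 2 2 _ = s≤s (s≤s (s≤s z≤n))
  least (suc (suc (suc _))) _ (feasible (s≤s (s≤s ())) _ _ _)
  least _ (suc (suc (suc _))) (feasible _ (s≤s (s≤s ())) _ _)

theorem2p1 :
  (∀ n m k → .{{_ : NonZero n}} → .{{_ : NonZero m}} → .{{_ : NonZero k}} →
    (n , m) ≢ (1 , 1) → (n , m) ≢ (2 , 2) →
    (sg[ K n m ]≡ k) ⇔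
      ((n < k × + m ≡ f (+ k) (+ n)) ⊎
       (m < k × + n ≡ f (+ k) (+ m)) ⊎
       (∃[ i ] (0ℤ ℤ.≤ i × i ℤ.≤ + k ×
         (f (+ k) (i ℤ.- 1ℤ) ℤ.≤ + m × + m ℤ.≤ f (+ k) i) ×
         (f (+ k) (+ k ℤ.- i ℤ.- 1ℤ) ℤ.≤ + n × + n ℤ.≤ f (+ k) (+ k ℤ.- i))))))
  × (sg[ K 1 1 ]≡ 2) × (sg[ K 2 2 ]≡ 3)
theorem2p1 = characterization , minimal⇒sg minimal-1-1 , minimal⇒sg minimal-2-2
  where
  characterization : ∀ n m k → .{{_ : NonZero n}} → .{{_ : NonZero m}} → .{{_ : NonZero k}} →
    (n , m) ≢ (1 , 1) → (n , m) ≢ (2 , 2) →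
    (sg[ K n m ]≡ k) ⇔ (ExtremalF n m k ⊎ ExtremalF m n k ⊎ BalancedF n m k)
  characterization (suc n) (suc m) (suc k) ≢1 ≢2 = mk⇔
    (Sum.map extremal⇒ (Sum.map extremal⇒ balanced⇒) ∘ minimal⇒extremal⊎balanced (s≤s z≤n) (s≤s z≤n) u ∘ sg⇒minimal)
    (minimal⇒sg ∘ extremal⊎balanced⇒minimal (s≤s z≤n) (s≤s z≤n) u ∘ Sum.map extremal⇐ (Sum.map extremal⇐ balanced⇐))
    where
    u : Unexceptional (suc n) (suc m)
    u = unexceptional ≢1 ≢2
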